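{- Let $P$ be a finite bicolored poset with $n$ elements and set of celeste elements $C$, let $\omega : P \to [n]$ be a reverse natural labeling of $P$, and let $\tau : P \to [n]$ be a natural labeling of $P$. Then \[ \Omega^{\circ}_{P,C}(x,y) \;=\; \sum_{L} \Omega^{\circ}_{\omega_L}(x,y) \qquad\text{and}\qquad \Omega_{P,C}(x,y) \;=\; \sum_{L} \Omega_{\tau_L}(x,y), \] where both sums are over all linear extensions $L$ of $P$ and $x,y$ are nonnegative integers.
   Context: $[x]=\{1,\dots,x\}$. A bicolored poset is a finite poset $(P,\preceq)$ written as a disjoint union of two subsets $C$ (celeste elements) and $S$ (silver elements). An order preserving $(x,y)$-map is a map $\varphi : P \to [x]$ such that $a \preceq b$ implies $\varphi(a) \le \varphi(b)$ for all $a,b \in P$, and $\varphi(c) \ge y$ for all $c \in C$. A strictly order preserving $(x,y)$-map is a map $\varphi : P \to [x]$ such that $a \prec b$ implies $\varphi(a) < \varphi(b)$ for all $a,b\in P$, and $\varphi(c) > y$ for all $c \in C$. $\Omega_{P,C}(x,y)$ and $\Omega^{\circ}_{P,C}(x,y)$ are the numbers of order preserving $(x,y)$-maps and of strictly order preserving $(x,y)$-maps, respectively. A labeling of $P$ is a bijection $\omega: P \to [n]$; it is natural if $a \prec b$ implies $\omega(a)<\omega(b)$, and reverse natural if $a\prec b$ implies $\omega(a)>\omega(b)$. A linear extension of $P$ is a chain $L = \{a_1 \prec a_2 \prec \cdots \prec a_n\}$ on the same underlying set (with the same celeste/silver partition) such that $a \preceq_P b$ implies $a \preceq_L b$. For a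 labeling $\omega$, the associated word is $\omega_L = \omega(a_1)\omega(a_2)\cdots\omega(a_n)$, with $\operatorname{Asc}(\omega_L)=\{j : \omega(a_j)<\omega(a_{j+1})\}$ and $\operatorname{Des}(\omega_L)=\{j : \omega(a_j)>\omega(a_{j+1})\}$. A map $\varphi: L \to [x]$ is of type $\omega_L$ if $\varphi(a_i)\le\varphi(a_{i+1})$ for all $i\in\operatorname{Asc}(\omega_L)$ and $\varphi(a_i)<\varphi(a_{i+1})$ for all $i\in\operatorname{Des}(\omega_L)$. $\Omega_{\omega_L}(x,y)$ is the number of maps $\varphi : L \to [x]$ of type $\omega_L$ with $\varphi(c)\ge y$ for all $c\in C$ (equivalently, for the minimal celeste element of $L$, if there is one); $\Omega^{\circ}_{\omega_L}(x,y)$ is the number of maps $\varphi : L \to [x]$ of type $\omega_L$ with $\varphi(c) > y$ for all $c \in C$. $\Omega_{\tau_L}$ is defined in the same way with $\tau$ in place of $\omega$. -}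

module Defs where

open import Data.Fin.Base using (Fin; zero; suc; toℕ; inject₁; finToFun; _≤_; _<_; _>_)
open import Data.Fin.Properties using (all?; any?; _≤?_; _<?_)
  renaming (_≟_ to _≟ᶠ_)
open import Data.List.Base using (List; map; filter; length; allFin)
open import Data.Nat.Base as ℕ using (ℕ; zero; suc; pred; _^_)
import Data.Nat.Properties as ℕ
open import Data.Nat.ListAction using (sum)
open import Data.Product.Base using (_×_)
open import Function.Base using (_∘_)
open import Function.Bundles using (_↔_; _⤖_; Inverse; Bijection)
open import Function.Consequences.Propositional
  using (strictlySurjective⇒surjective; surjective⇒strictlySurjective)
open import Function.Definitions using (Bijective)
open import Relation.Binary.Definitions using (DecidableEquality) renaming (Decidable to Decidable₂)
open import Relation.Binary.PropositionalEquality using (_≡_; refl; subst)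
open import Relation.Binary.Structures using (IsDecPartialOrder)
import Relation.Binary.Construct.NonStrictToStrict as ToStrict
open import Relation.Nullary using (Dec; yes; no)
open import Relation.Nullary.Decidable using (map′; _×-dec_; _→-dec_)
open import Level using (0ℓ)
open import Relation.Unary using (Pred; Decidable)

data Colour : Set where
  celeste silver : Colour

_≟ᶜ_ : DecidableEquality Colour
celeste ≟ᶜ celeste = yes refl
celeste ≟ᶜ silver  = no λ ()
silver  ≟ᶜ celeste = no λ ()
silver  ≟ᶜ silver  = yes refl

-- `index` witnesses finiteness and is otherwise unrelated to the order; it is
-- used only to enumerate maps and listings.
record BicolouredPoset (n : ℕ) : Set₁ where
  infix 4 _⪯_
  field
    Carrier           : Set
    _⪯_               : Carrier → Carrier → Set
    isDecPartialOrder : IsDecPartialOrder _≡_ _⪯_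
    colour            : Carrier → Colour
    index             : Carrier ↔ Fin n

  open IsDecPartialOrder isDecPartialOrder public
    using (_≟_; antisym) renaming (_≤?_ to _⪯?_; refl to ⪯-refl; trans to ⪯-trans)

  open ToStrict _≡_ _⪯_ public using () renaming (_<_ to _≺_)

  _≺?_ : Decidable₂ _≺_
  _≺?_ = ToStrict.<-decidable _≡_ _⪯_ _≟_ _⪯?_

  C : Pred Carrier 0ℓ
  C a = colour a ≡ celeste

  C? : Decidable C
  C? a = colour a ≟ᶜ celeste

  ∀? : ∀ {Q : Pred Carrier 0ℓ} → Decidable Q → Dec (∀ a → Q a)
  ∀? {Q} Q? = map′ (λ q a → subst Q (Inverse.strictlyInverseʳ index a) (q (Inverse.to index a)))
                   (λ q i → q (Inverse.from index i))
                   (all? (Q? ∘ Inverse.from index))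

-- The interval [x] = {1,…,x} is Fin x, with i : Fin x standing for ⟦ i ⟧.
⟦_⟧ : ∀ {x} → Fin x → ℕ
⟦ i ⟧ = suc (toℕ i)

-- Positions j = 1,…,n-1 of a word of length n, and the letters j and j+1.
this next : ∀ {n} → Fin (pred n) → Fin n
this {suc n} = inject₁
next {suc n} = suc

Asc Des : ∀ {n m} → (Fin n → Fin m) → Pred (Fin (pred n)) 0ℓ
Asc w j = w (this j) < w (next j)
Des w j = w (this j) > w (next j)

module _ {n : ℕ} (P : BicolouredPoset n) where
  open BicolouredPoset P

  Labelling : Set
  Labelling = Carrier ⤖ Fin n

  Natural ReverseNatural : Labelling → Set
  Natural        ω = ∀ {a b} → a ≺ b → Bijection.to ω a < Bijection.to ω b
  ReverseNatural ω = ∀ {a b} → a ≺ b → Bijection.to ω a > Bijection.to ω b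

  -- finToFun is a bijection (up to pointwise equality) from Fin (x ^ n) onto
  -- Fin n → Fin x, so each map occurs exactly once.
  maps : ∀ x → List (Carrier → Fin x)
  maps x = map (λ k → finToFun k ∘ Inverse.to index) (allFin (x ^ n))

  number : ∀ {x} {Q : Pred (Carrier → Fin x) 0ℓ} → Decidable Q → ℕ
  number {x} Q? = length (filter Q? (maps x))

  CelesteAtLeast CelesteAbove : ∀ {x} → ℕ → Pred (Carrier → Fin x) 0ℓ
  CelesteAtLeast y φ = ∀ c → C c → ⟦ φ c ⟧ ℕ.≥ y
  CelesteAbove   y φ = ∀ c → C c → ⟦ φ c ⟧ ℕ.> y

  celesteAtLeast? : ∀ {x} y → Decidable (CelesteAtLeast {x} y)
  celesteAtLeast? y φ = ∀? λ c → C? c →-dec (y ℕ.≤? ⟦ φ c ⟧)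

  celesteAbove? : ∀ {x} y → Decidable (CelesteAbove {x} y)
  celesteAbove? y φ = ∀? λ c → C? c →-dec (y ℕ.<? ⟦ φ c ⟧)

  OrderPreserving StrictlyOrderPreserving : ∀ x → ℕ → Pred (Carrier → Fin x) 0ℓ
  OrderPreserving         x y φ = (∀ a b → a ⪯ b → φ a ≤ φ b) × CelesteAtLeast y φ
  StrictlyOrderPreserving x y φ = (∀ a b → a ≺ b → φ a < φ b) × CelesteAbove y φ

  orderPreserving? : ∀ x y → Decidable (OrderPreserving x y)
  orderPreserving? x y φ =
    (∀? λ a → ∀? λ b → (a ⪯? b) →-dec (φ a ≤? φ b)) ×-dec celesteAtLeast? y φ

  strictlyOrderPreserving? : ∀ x y → Decidable (StrictlyOrderPreserving x y)
  strictlyOrderPreserving? x y φ =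
    (∀? λ a → ∀? λ b → (a ≺? b) →-dec (φ a <? φ b)) ×-dec celesteAbove? y φ

  Ω Ω° : ℕ → ℕ → ℕ
  Ω  x y = number (orderPreserving? x y)
  Ω° x y = number (strictlyOrderPreserving? x y)

  -- A chain L = {a₁ ≺ ⋯ ≺ aₙ} on the underlying set of P is given by the
  -- bijective listing i ↦ aᵢ; in it, L i ⪯_L L j means i ≤ j.
  Listing : Set
  Listing = Fin n → Carrier

  IsLinearExtension : Pred Listing 0ℓ
  IsLinearExtension L = Bijective _≡_ _≡_ L × (∀ i j → L i ⪯ L j → i ≤ j)

  isLinearExtension? : Decidable IsLinearExtension
  isLinearExtension? L = bijective? ×-dec all? λ i → all? λ j → (L i ⪯? L j) →-dec (i ≤? j)
    where
    bijective? : Dec (Bijective _≡_ _≡_ L)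
    bijective? =
      map′ (λ f {i} {j} → f i j) (λ f i j → f {i} {j})
           (all? λ i → all? λ j → (L i ≟ L j) →-dec (i ≟ᶠ j))
      ×-dec
      map′ strictlySurjective⇒surjective surjective⇒strictlySurjective
           (∀? λ a → any? λ i → L i ≟ a)

  linearExtensions : List Listing
  linearExtensions =
    filter isLinearExtension? (map (λ k → Inverse.from index ∘ finToFun k) (allFin (n ^ n)))

  word : Labelling → Listing → Fin n → Fin n
  word ω L = Bijection.to ω ∘ L

  OfType : Labelling → Listing → ∀ {x} → Pred (Carrier → Fin x) 0ℓ
  OfType ω L φ =
    (∀ i → Asc (word ω L) i → φ (L (this i)) ≤ φ (L (next i))) ×
    (∀ i → Des (word ω L) i → φ (L (this i)) < φ (L (next i)))

  ofType? : ∀ ω L {x} → Decidable (OfType ω L {x})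
  ofType? ω L φ =
    all? (λ i → (word ω L (this i) <? word ω L (next i)) →-dec (φ (L (this i)) ≤? φ (L (next i))))
    ×-dec
    all? (λ i → (word ω L (next i) <? word ω L (this i)) →-dec (φ (L (this i)) <? φ (L (next i))))

  Ωʷ Ωʷ° : Labelling → Listing → ℕ → ℕ → ℕ
  Ωʷ  ω L x y = number {x} λ φ → ofType? ω L φ ×-dec celesteAtLeast? y φ
  Ωʷ° ω L x y = number {x} λ φ → ofType? ω L φ ×-dec celesteAbove? y φ

  ∑ᴸ : (Listing → ℕ) → ℕ
  ∑ᴸ f = sum (map f linearExtensions)

{-# OPTIONS --safe #-}

-- Fix a labelling ℓ. For φ : P → [x], order P totally by the lexicographic key
-- a ↦ (φ a , ℓ a). A listing L makes φ a map of type ℓ_L exactly when the keys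
-- increase strictly along L, so there is exactly one such listing, and it is a
-- linear extension exactly when the key is strictly monotone on P. For a natural
-- labelling the latter says that φ is order preserving, for a reverse natural
-- one that φ is strictly order preserving. Both identities then follow by
-- counting the pairs (L , φ) in two ways.
module Submission where

open import Defs
open import Algebra.Properties.CommutativeSemigroup using (interchange)
open import Data.Bool.Base using (true; false; if_then_else_)
open import Data.Fin.Base
  using (Fin; zero; suc; combine; finToFun; funToFin; fromℕ<; toℕ; inject₁; punchOut; _≤_; _<_)
open import Data.Fin.Induction using (<-weakInduction)
open import Data.Fin.Properties
  using (any?; _<?_; _≟_; <-cmp; <-trans; <-irrefl; <⇒≢; ≤-refl; ≤-reflexive; ≤-antisym;
         toℕ-injective; toℕ-inject₁; toℕ-fromℕ<; ≤̄⇒inject₁<; punchOut-injective; injective⇒≤;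
         toℕ-combine; combine-injectiveʳ; combine-monoˡ-<; finToFun-funToFin; funToFin-finToFin)
open import Data.List.Base using (List; []; _∷_; map; filter; length; allFin)
open import Data.List.Membership.Propositional using (_∈_; lose)
open import Data.List.Membership.Propositional.Properties using (∈-allFin; ∈-filter⁺)
open import Data.List.Properties
  using (filter-notAll; filter-none; filter-accept; filter-reject; length-tabulate)
open import Data.List.Relation.Unary.All as All using (_∷_)
open import Data.List.Relation.Unary.Any using (here; there)
open import Data.List.Relation.Unary.Unique.Propositional using (Unique; _∷_)
open import Data.List.Relation.Unary.Unique.Propositional.Properties using (allFin⁺)
open import Data.Nat.Base as ℕ using (ℕ; zero; suc; _+_; _*_; pred; z≤n; s≤s; s<s)
open import Data.Nat.ListAction using (sum)
import Data.Nat.Properties as ℕ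
open import Data.Product.Base using (_×_; _,_; proj₁; proj₂; ∃)
open import Function.Base using (_∘_)
open import Function.Bundles using (_↔_; Inverse; Injection; Bijection; _⇔_; mk⇔; Equivalence)
open import Function.Consequences.Propositional
  using (strictlySurjective⇒surjective; surjective⇒strictlySurjective)
open import Function.Definitions using (Injective; StrictlySurjective)
open import Function.Properties.Inverse using (↔-sym; ↔⇒↣)
open import Relation.Binary.Definitions using (tri<; tri≈; tri>)
open import Relation.Binary.PropositionalEquality
  using (_≡_; _≢_; _≗_; refl; sym; trans; cong; cong₂; subst; subst₂; module ≡-Reasoning)
open import Relation.Nullary using (Dec; yes; no; does; ¬_; contradiction)
open import Relation.Nullary.Decidable using (_×-dec_)
open import Relation.Unary using (Pred; Decidable; _⊆_)
open import Level using (Level; 0ℓ)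

private variable
  p q r : Level
  A B : Set
  m n x : ℕ

-- Counting by filtered lists.

𝟙 : {X : Set p} → Dec X → ℕ
𝟙 d = if does d then 1 else 0

length-filter-∷ : {Q : Pred A q} (Q? : Decidable Q) (a : A) (as : List A) →
  length (filter Q? (a ∷ as)) ≡ 𝟙 (Q? a) + length (filter Q? as)
length-filter-∷ Q? a as with does (Q? a)
... | true  = refl
... | false = refl

sum-map-𝟙 : {Q : Pred A q} (Q? : Decidable Q) (as : List A) →
  sum (map (λ a → 𝟙 (Q? a)) as) ≡ length (filter Q? as)
sum-map-𝟙 Q? []       = refl
sum-map-𝟙 Q? (a ∷ as) =
  trans (cong (𝟙 (Q? a) +_) (sum-map-𝟙 Q? as)) (sym (length-filter-∷ Q? a as))

sum-map-+ : (f g : A → ℕ) (as : List A) →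
  sum (map (λ a → f a + g a) as) ≡ sum (map f as) + sum (map g as)
sum-map-+ f g []       = refl
sum-map-+ f g (a ∷ as) = trans (cong (f a + g a +_) (sum-map-+ f g as))
  (interchange ℕ.+-commutativeSemigroup (f a) (g a) _ _)

sum-map-0 : (bs : List B) → sum (map (λ _ → 0) bs) ≡ 0
sum-map-0 []       = refl
sum-map-0 (_ ∷ bs) = sum-map-0 bs

sum-map-cong : {f g : A → ℕ} → f ≗ g → (as : List A) → sum (map f as) ≡ sum (map g as)
sum-map-cong f≗g []       = refl
sum-map-cong f≗g (a ∷ as) = cong₂ _+_ (f≗g a) (sum-map-cong f≗g as)

-- Both sides count the pairs related by `R`, grouped by `a` on the left and by `b` on the right.
-- Induction on `as` adds one row of the incidence table at a time, and `fibre` evaluates the row.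
double-count : {Q : Pred A q} (Q? : Decidable Q)
  {R : B → Pred A r} (R? : ∀ b → Decidable (R b)) (bs : List B) →
  (∀ a → 𝟙 (Q? a) ≡ length (filter (λ b → R? b a) bs)) →
  ∀ as → length (filter Q? as) ≡ sum (map (λ b → length (filter (R? b) as)) bs)
double-count Q? R? bs fibre []       = sym (sum-map-0 bs)
double-count Q? R? bs fibre (a ∷ as) = begin
  length (filter Q? (a ∷ as))
    ≡⟨ length-filter-∷ Q? a as ⟩
  𝟙 (Q? a) + length (filter Q? as)
    ≡⟨ cong₂ _+_ (trans (fibre a) (sym (sum-map-𝟙 (λ b → R? b a) bs)))
                 (double-count Q? R? bs fibre as) ⟩
  sum (map (λ b → 𝟙 (R? b a)) bs) + sum (map (λ b → length (filter (R? b) as)) bs)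
    ≡⟨ sum-map-+ _ _ bs ⟨
  sum (map (λ b → 𝟙 (R? b a) + length (filter (R? b) as)) bs)
    ≡⟨ sum-map-cong (λ b → length-filter-∷ (R? b) a as) bs ⟨
  sum (map (λ b → length (filter (R? b) (a ∷ as))) bs) ∎
  where open ≡-Reasoning

-- Turns existence and uniqueness of a sorted listing into a count of one.
length-filter-unique : {Q : Pred A q} (Q? : Decidable Q) {a : A} {as : List A} →
  Unique as → a ∈ as → Q a → (∀ {b} → Q b → b ≡ a) → length (filter Q? as) ≡ 1
length-filter-unique Q? (a∉as ∷ _) (here refl) qa only =
  trans (cong length (filter-accept Q? qa))
        (cong (suc ∘ length) (filter-none Q? (All.map (λ a≢b qb → a≢b (sym (only qb))) a∉as)))
length-filter-unique Q? (b∉as ∷ unique) (there a∈as) qa only =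
  trans (cong length (filter-reject Q? (λ qb → All.lookup b∉as a∈as (only qb))))
        (length-filter-unique Q? unique a∈as qa only)

-- Moves a count of listings back to their codes. Listings are functions and agree only pointwise,
-- whereas codes can be compared by `_≡_`.
length-filter-filter-map : {P : Pred B p} (P? : Decidable P) {Q : Pred B q} (Q? : Decidable Q)
  (f : A → B) (as : List A) →
  length (filter Q? (filter P? (map f as))) ≡ length (filter (λ a → P? (f a) ×-dec Q? (f a)) as)
length-filter-filter-map P? Q? f []       = refl
length-filter-filter-map P? Q? f (a ∷ as) with does (P? (f a))
... | false = length-filter-filter-map P? Q? f as
... | true with does (Q? (f a))
...   | false = length-filter-filter-map P? Q? f as
...   | true  = cong suc (length-filter-filter-map P? Q? f as)

filter-filter-⊆ : {P : Pred A p} (P? : Decidable P) {Q : Pred A q} (Q? : Decidable Q) →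
  P ⊆ Q → ∀ as → filter P? (filter Q? as) ≡ filter P? as
filter-filter-⊆ P? Q? P⊆Q []       = refl
filter-filter-⊆ P? Q? P⊆Q (a ∷ as) with Q? a
... | no ¬qa = trans (filter-filter-⊆ P? Q? P⊆Q as) (sym (filter-reject P? (¬qa ∘ P⊆Q)))
... | yes _ with does (P? a)
...   | true  = cong (a ∷_) (filter-filter-⊆ P? Q? P⊆Q as)
...   | false = filter-filter-⊆ P? Q? P⊆Q as

-- Filtering by `P?` may be done after filtering by `Q?`, and this second pass discards `a`.
length-filter-⊂ : {P : Pred A p} (P? : Decidable P) {Q : Pred A q} (Q? : Decidable Q) →
  P ⊆ Q → ∀ {a as} → a ∈ as → Q a → ¬ P a →
  length (filter P? as) ℕ.< length (filter Q? as)
length-filter-⊂ P? Q? P⊆Q {as = as} a∈as qa ¬pa =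
  subst (ℕ._< length (filter Q? as)) (cong length (filter-filter-⊆ P? Q? P⊆Q as))
    (filter-notAll P? (filter Q? as) (lose (∈-filter⁺ Q? a∈as qa) ¬pa))

-- Finite sets and their codes.

funToFin-cong : {f g : Fin m → Fin n} → f ≗ g → funToFin f ≡ funToFin g
funToFin-cong {zero}  f≗g = refl
funToFin-cong {suc m} f≗g = cong₂ combine (f≗g zero) (funToFin-cong (f≗g ∘ suc))

finToFun-injective : {i j : Fin (n ℕ.^ m)} → finToFun {n} {m} i ≗ finToFun j → i ≡ j
finToFun-injective {n} {m} {i} {j} eq =
  trans (sym (funToFin-finToFin {m} {n} i)) (trans (funToFin-cong eq) (funToFin-finToFin {m} {n} j))

-- Pigeonhole: punching a missed value `j` out of the codomain would leave an injection from
-- `Fin (suc n)` to `Fin n`.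
injective⇒strictlySurjective : {f : Fin n → Fin n} → Injective _≡_ _≡_ f → StrictlySurjective _≡_ f
injective⇒strictlySurjective {suc n} {f} inj j with any? (λ i → f i ≟ j)
... | yes found = found
... | no ¬found = contradiction
  (injective⇒≤ {f = λ i → punchOut (j≢f i)}
    (λ {i} {i′} eq → inj (punchOut-injective (j≢f i) (j≢f i′) eq)))
  ℕ.1+n≰n
  where
  j≢f : ∀ i → j ≢ f i
  j≢f i eq = ¬found (i , sym eq)

combine-monoʳ-< : (i : Fin m) {j k : Fin n} → j < k → combine i j < combine i k
combine-monoʳ-< {n = n} i {j} {k} j<k
  rewrite toℕ-combine i j | toℕ-combine i k = ℕ.+-monoʳ-< _ j<k

-- Strictly increasing sequences and uniqueness of sorted listings.

StrictlyIncreasing : (Fin n → Fin m) → Set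
StrictlyIncreasing f = ∀ {i j} → i < j → f i < f j

this<next : (j : Fin (pred n)) → this {n} j < next {n} j
this<next {suc n} j = ≤̄⇒inject₁< ≤-refl

consecutive⇒strictlyIncreasing : (f : Fin n → Fin m) → (∀ j → f (this j) < f (next j)) →
  StrictlyIncreasing f
consecutive⇒strictlyIncreasing {suc (suc n)} f step {zero} {suc zero} _ = step zero
consecutive⇒strictlyIncreasing {suc (suc n)} f step {zero} {suc (suc j)} _ =
  <-trans (step zero)
    (consecutive⇒strictlyIncreasing {suc n} (f ∘ suc) (step ∘ suc) {zero} {suc j} (s≤s z≤n))
consecutive⇒strictlyIncreasing {suc (suc n)} f step {suc i} {suc j} (s<s i<j) =
  consecutive⇒strictlyIncreasing {suc n} (f ∘ suc) (step ∘ suc) i<j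

strictlyIncreasing⇒inflationary : {f : Fin n → Fin m} → StrictlyIncreasing f → ∀ i → i ≤ f i
strictlyIncreasing⇒inflationary {suc n} {f = f} inc =
  <-weakInduction (λ i → i ≤ f i) z≤n λ i i≤fi →
    ℕ.≤-<-trans (subst (ℕ._≤ toℕ (f (inject₁ i))) (toℕ-inject₁ i) i≤fi) (inc (≤̄⇒inject₁< ≤-refl))

strictlyIncreasing⇒reflecting : {f : Fin n → Fin m} → StrictlyIncreasing f →
  ∀ {i j} → f i < f j → i < j
strictlyIncreasing⇒reflecting inc {i} {j} fi<fj with <-cmp i j
... | tri< i<j _ _  = i<j
... | tri≈ _ refl _ = contradiction fi<fj (<-irrefl refl)
... | tri> _ _ j<i  = contradiction (<-trans fi<fj (inc j<i)) (<-irrefl refl)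

strictlyIncreasing⇒injective : {f : Fin n → Fin m} → StrictlyIncreasing f → Injective _≡_ _≡_ f
strictlyIncreasing⇒injective inc {i} {j} eq with <-cmp i j
... | tri< i<j _ _ = contradiction eq (<⇒≢ (inc i<j))
... | tri≈ _ i≡j _ = i≡j
... | tri> _ _ j<i = contradiction (sym eq) (<⇒≢ (inc j<i))

IsSortedListing : (A → Fin m) → (Fin n → A) → Set
IsSortedListing key L = StrictlySurjective _≡_ L × StrictlyIncreasing (key ∘ L)

module _ {key : A → Fin m} {L L′ : Fin n → A} where

  sorted-≗ : L ≗ L′ → IsSortedListing key L → IsSortedListing key L′
  sorted-≗ L≗L′ (surj , inc) =
    (λ a → let i , Li≡a = surj a in i , trans (sym (L≗L′ i)) Li≡a) ,
    λ {i} {j} i<j → subst₂ (λ a b → key a < key b) (L≗L′ i) (L≗L′ j) (inc i<j)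

  -- The keys along `L′` reflect the order of positions, so `g` is itself strictly increasing.
  reindexing-inflationary : StrictlyIncreasing (key ∘ L) → StrictlyIncreasing (key ∘ L′) →
    {g : Fin n → Fin n} → L′ ∘ g ≗ L → ∀ i → i ≤ g i
  reindexing-inflationary inc inc′ L′g≗L = strictlyIncreasing⇒inflationary λ {i} {j} i<j →
    strictlyIncreasing⇒reflecting inc′
      (subst₂ (λ a b → key a < key b) (sym (L′g≗L i)) (sym (L′g≗L j)) (inc i<j))

-- The reindexings `g` from `L` to `L′` and `h` back are both inflationary and `h` undoes `g`, so
-- `i ≤ g i ≤ h (g i) ≡ i` forces `g` to be the identity.
sorted-unique : {key : A → Fin m} {L L′ : Fin n → A} →
  IsSortedListing key L → IsSortedListing key L′ → L ≗ L′
sorted-unique {n = n} {key = key} {L} {L′} (surj , inc) (surj′ , inc′) i =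
  trans (sym (L′g≗L i)) (cong L′ (sym i≡gi))
  where
  g h : Fin n → Fin n
  g = proj₁ ∘ surj′ ∘ L
  h = proj₁ ∘ surj ∘ L′

  L′g≗L : L′ ∘ g ≗ L
  L′g≗L = proj₂ ∘ surj′ ∘ L

  Lh≗L′ : L ∘ h ≗ L′
  Lh≗L′ = proj₂ ∘ surj ∘ L′

  hgi≡i : h (g i) ≡ i
  hgi≡i = strictlyIncreasing⇒injective inc (cong key (trans (Lh≗L′ (g i)) (L′g≗L i)))

  i≡gi : i ≡ g i
  i≡gi = ≤-antisym (reindexing-inflationary {key = key} inc inc′ L′g≗L i)
    (subst (g i ≤_) hgi≡i (reindexing-inflationary {key = key} inc′ inc Lh≗L′ (g i)))

-- Existence of a sorted listing.

module _ (index : A ↔ Fin n) {key : A → Fin m} (key-injective : Injective _≡_ _≡_ key) where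
  private
    open Inverse index using (to; from; strictlyInverseʳ)

    below? : ∀ a → Decidable (λ i → key (from i) < key a)
    below? a i = key (from i) <? key a

    -- The position, counted from zero, that `a` must take in a sorted listing.
    count : A → ℕ
    count a = length (filter (below? a) (allFin n))

    count<n : ∀ a → count a ℕ.< n
    count<n a = subst (count a ℕ.<_) (length-tabulate {n = n} (λ i → i))
      -- The index of `a` itself is dropped, since no key is below itself.
      (filter-notAll (below? a) (allFin n)
        (lose (∈-allFin (to a)) (<-irrefl (cong key (strictlyInverseʳ a)))))

    rank : A → Fin n
    rank a = fromℕ< (count<n a)

    -- Everything below `a` is below `b`, and `a` is counted for `b` but not for itself.
    rank-mono : ∀ {a b} → key a < key b → rank a < rank b
    rank-mono {a} {b} a<b
      rewrite toℕ-fromℕ< (count<n a) | toℕ-fromℕ< (count<n b) =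
      length-filter-⊂ (below? a) (below? b) (λ i<a → <-trans i<a a<b) (∈-allFin (to a))
        (subst (λ c → key c < key b) (sym (strictlyInverseʳ a)) a<b)
        (<-irrefl (cong key (strictlyInverseʳ a)))

    rank-injective : ∀ {a b} → rank a ≡ rank b → a ≡ b
    rank-injective {a} {b} eq with <-cmp (key a) (key b)
    ... | tri< a<b _ _ = contradiction eq (<⇒≢ (rank-mono a<b))
    ... | tri≈ _ a≡b _ = key-injective a≡b
    ... | tri> _ _ b<a = contradiction (sym eq) (<⇒≢ (rank-mono b<a))

    rank-reflects : ∀ {a b} → rank a < rank b → key a < key b
    rank-reflects {a} {b} lt with <-cmp (key a) (key b)
    ... | tri< a<b _ _ = a<b
    ... | tri≈ _ a≡b _ = contradiction lt (<-irrefl (cong rank (key-injective a≡b)))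
    ... | tri> _ _ b<a = contradiction (<-trans lt (rank-mono b<a)) (<-irrefl refl)

    -- Transported along `index`, `rank` is an injective self-map of `Fin n`. Its inverse is the
    -- sorted listing.
    rank-surjective : ∀ i → ∃ λ a → rank a ≡ i
    rank-surjective i =
      let j , eq = injective⇒strictlySurjective {f = rank ∘ from}
                     (λ eq → Injection.injective (↔⇒↣ (↔-sym index)) (rank-injective eq)) i
      in from j , eq

  sort : ∃ λ (L : Fin n → A) → IsSortedListing key L
  sort = L , (λ a → rank a , rank-injective (rank∘L (rank a))) ,
    λ {i} {j} i<j → rank-reflects (subst₂ _<_ (sym (rank∘L i)) (sym (rank∘L j)) i<j)
    where
    L : Fin n → A
    L = proj₁ ∘ rank-surjective

    rank∘L : ∀ i → rank (L i) ≡ i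
    rank∘L = proj₂ ∘ rank-surjective

-- The lexicographic key of a map.

module _ {n : ℕ} (P : BicolouredPoset n) (ℓ : Labelling P) where
  open BicolouredPoset P hiding (C; C?) renaming (_≟_ to _≟ᴾ_)
  open Inverse index using (to; from; strictlyInverseʳ)
  open Bijection ℓ using () renaming (to to label; injective to label-injective)

  -- `combine i j` has the value `n * i + j` with `j` below `n`, so the order of `Fin (x * n)` is
  -- the lexicographic order on pairs, with `φ` compared first.
  lexKey : (Carrier → Fin x) → Carrier → Fin (x * n)
  lexKey φ a = combine (φ a) (label a)

  LexMonotone : (Carrier → Fin x) → Set
  LexMonotone φ = ∀ {a b} → a ≺ b → lexKey φ a < lexKey φ b

  module _ (φ : Carrier → Fin x) where

    lexKey-injective : Injective _≡_ _≡_ (lexKey φ)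
    lexKey-injective eq = label-injective (combine-injectiveʳ (φ _) _ (φ _) _ eq)

    lexKey-< : ∀ {a b} → φ a ≤ φ b → label a < label b → lexKey φ a < lexKey φ b
    lexKey-< {a} {b} φa≤φb la<lb with <-cmp (φ a) (φ b)
    ... | tri< φa<φb _ _ = combine-monoˡ-< (label a) (label b) φa<φb
    ... | tri≈ _ φa≡φb _ = subst (λ c → lexKey φ a < combine c (label b)) φa≡φb
                             (combine-monoʳ-< (φ a) la<lb)
    ... | tri> _ _ φb<φa = contradiction φa≤φb (ℕ.<⇒≱ φb<φa)

    lexKey-<⇒≤ : ∀ {a b} → lexKey φ a < lexKey φ b → φ a ≤ φ b
    lexKey-<⇒≤ {a} {b} lt = ℕ.≮⇒≥ λ φb<φa →
      ℕ.<-asym lt (combine-monoˡ-< (label b) (label a) φb<φa)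

    -- A drop in the label has to be outweighed by `φ`: if `φ b ≤ φ a`, then `lexKey-<` would order
    -- the keys the other way.
    lexKey-<⇒< : ∀ {a b} → label b < label a → lexKey φ a < lexKey φ b → φ a < φ b
    lexKey-<⇒< {a} {b} lb<la lt = ℕ.≰⇒> λ φb≤φa → ℕ.<-asym lt (lexKey-< φb≤φa lb<la)

    -- At an ascent the label breaks a possible tie of `φ`; at a descent `φ` increases strictly and
    -- decides alone.
    ofType⇒sorted : ∀ {L} → Injective _≡_ _≡_ L → OfType P ℓ L φ → StrictlyIncreasing (lexKey φ ∘ L)
    ofType⇒sorted {L} L-injective (asc , des) = consecutive⇒strictlyIncreasing (lexKey φ ∘ L) step
      where
      step : ∀ j → lexKey φ (L (this j)) < lexKey φ (L (next j))
      step j with <-cmp (label (L (this j))) (label (L (next j)))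
      ... | tri< lt _ _ = lexKey-< (asc j lt) lt
      -- Adjacent letters differ, so every position is an ascent or a descent.
      ... | tri≈ _ eq _ = contradiction (L-injective (label-injective eq)) (<⇒≢ (this<next {n} j))
      ... | tri> _ _ gt = combine-monoˡ-< _ _ (des j gt)

    sorted⇒ofType : ∀ {L} → StrictlyIncreasing (lexKey φ ∘ L) → OfType P ℓ L φ
    sorted⇒ofType inc =
      (λ j _ → lexKey-<⇒≤ (inc (this<next {n} j))) ,
      (λ j gt → lexKey-<⇒< gt (inc (this<next {n} j)))

    -- A relation `L i ≺ L j` increases the key, and a sorted listing reflects that increase to
    -- `i < j`.
    sorted⇒linearExtension : LexMonotone φ → ∀ {L} → IsSortedListing (lexKey φ) L →
      IsLinearExtension P L
    sorted⇒linearExtension mono {L} (surj , inc) =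
      (L-injective , strictlySurjective⇒surjective surj) , compatible
      where
      L-injective : Injective _≡_ _≡_ L
      L-injective = strictlyIncreasing⇒injective inc ∘ cong (lexKey φ)

      compatible : ∀ i j → L i ⪯ L j → i ≤ j
      compatible i j Li⪯Lj with L i ≟ᴾ L j
      ... | yes Li≡Lj = ≤-reflexive (L-injective Li≡Lj)
      ... | no  Li≢Lj = ℕ.<⇒≤ (strictlyIncreasing⇒reflecting inc (mono (Li⪯Lj , Li≢Lj)))

    -- `L` places `a` strictly before `b`, and the type condition makes keys increase along `L`.
    linearExtension⇒lexMonotone : ∀ {L} → IsLinearExtension P L → OfType P ℓ L φ → LexMonotone φ
    linearExtension⇒lexMonotone {L} ((inj , surj) , compatible) type {a} {b} (a⪯b , a≢b)
      with surjective⇒strictlySurjective surj a | surjective⇒strictlySurjective surj b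
    ... | i , refl | j , refl =
      ofType⇒sorted inj type (ℕ.≤∧≢⇒< (compatible i j a⪯b) (a≢b ∘ cong L ∘ toℕ-injective))

    extension⇒sorted : ∀ {L} → IsLinearExtension P L → OfType P ℓ L φ →
      IsSortedListing (lexKey φ) L
    extension⇒sorted ((inj , surj) , _) type =
      surjective⇒strictlySurjective surj , ofType⇒sorted inj type

  -- The linear extensions belonging to one map.

  listing : Fin (n ℕ.^ n) → Listing P
  listing k = from ∘ finToFun k

  listing-injective : ∀ {k k′} → listing k ≗ listing k′ → k ≡ k′
  listing-injective eq = finToFun-injective {n} {n} (Injection.injective (↔⇒↣ (↔-sym index)) ∘ eq)

  listing-surjective : ∀ L → ∃ λ k → L ≗ listing k
  listing-surjective L = funToFin (to ∘ L) , λ i →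
    trans (sym (strictlyInverseʳ (L i))) (cong from (sym (finToFun-funToFin (to ∘ L) i)))

  -- The fibre of the double count over `φ`. `B` stands for the celeste condition, which depends on
  -- `φ` but not on `L`.
  extensions-ofType : (φ : Carrier → Fin x)
    {B : Set} (B? : Dec B) {Q : Set} (Q? : Dec Q) → Q ⇔ (LexMonotone φ × B) →
    𝟙 Q? ≡ length (filter (λ L → ofType? P ℓ L φ ×-dec B?) (linearExtensions P))
  extensions-ofType φ {B} B? Q? Q⇔ =
    trans (cases Q?)
      (sym (length-filter-filter-map (isLinearExtension? P) (λ L → ofType? P ℓ L φ ×-dec B?)
              listing (allFin (n ℕ.^ n))))
    where
    Sought : Pred (Fin (n ℕ.^ n)) 0ℓ
    Sought k = IsLinearExtension P (listing k) × OfType P ℓ (listing k) φ × B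

    sought? : Decidable Sought
    sought? k = isLinearExtension? P (listing k) ×-dec ofType? P ℓ (listing k) φ ×-dec B?

    cases : ∀ Q? → 𝟙 Q? ≡ length (filter sought? (allFin (n ℕ.^ n)))
    cases (no ¬q) = sym (cong length (filter-none sought? (All.universal none (allFin (n ℕ.^ n)))))
      where
      none : ∀ k → ¬ Sought k
      none k (ext , type , b) =
        ¬q (Equivalence.from Q⇔ (linearExtension⇒lexMonotone φ ext type , b))
    -- The witness is the code of the listing sorted by key. Any other sought code also gives a
    -- sorted listing, hence the same one.
    cases (yes q) =
      let mono , b = Equivalence.to Q⇔ q
          L , L-sorted = sort index (lexKey-injective φ)
          k , L≗k = listing-surjective L
          k-sorted = sorted-≗ {key = lexKey φ} L≗k L-sorted
      in sym (length-filter-unique sought? (allFin⁺ (n ℕ.^ n)) (∈-allFin k)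
           (sorted⇒linearExtension φ mono k-sorted , sorted⇒ofType φ (proj₂ k-sorted) , b)
           λ (ext , type , _) → listing-injective
             (sorted-unique {key = lexKey φ} (extension⇒sorted φ ext type) k-sorted))

  number≡∑ᴸ : {B Q : Pred (Carrier → Fin x) 0ℓ} (B? : Decidable B) (Q? : Decidable Q) →
    (∀ φ → Q φ ⇔ (LexMonotone φ × B φ)) →
    number P Q? ≡ ∑ᴸ P (λ L → number P (λ φ → ofType? P ℓ L φ ×-dec B? φ))
  number≡∑ᴸ B? Q? Q⇔ =
    double-count Q? (λ L φ → ofType? P ℓ L φ ×-dec B? φ) (linearExtensions P)
      (λ φ → extensions-ofType φ (B? φ) (Q? φ) (Q⇔ φ)) (maps P _)

  -- A strict increase of `φ` decides the key. Conversely, labels drop along `≺`, so an increasing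
  -- key forces a strict increase of `φ`.
  strictlyOrderPreserving⇔lexMonotone : ReverseNatural P ℓ → ∀ y (φ : Carrier → Fin x) →
    StrictlyOrderPreserving P x y φ ⇔ (LexMonotone φ × CelesteAbove P y φ)
  strictlyOrderPreserving⇔lexMonotone rev y φ = mk⇔
    (λ (strict , above) → (λ {a} {b} a≺b → combine-monoˡ-< _ _ (strict a b a≺b)) , above)
    (λ (mono , above) → (λ a b a≺b → lexKey-<⇒< φ (rev a≺b) (mono a≺b)) , above)

  -- Labels rise along `≺`, so they settle the ties that a weakly increasing `φ` leaves.
  orderPreserving⇔lexMonotone : Natural P ℓ → ∀ y (φ : Carrier → Fin x) →
    OrderPreserving P x y φ ⇔ (LexMonotone φ × CelesteAtLeast P y φ)
  orderPreserving⇔lexMonotone {x} nat y φ = mk⇔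
    (λ (weak , atLeast) →
      (λ {a} {b} a≺b → lexKey-< φ (weak a b (proj₁ a≺b)) (nat a≺b)) , atLeast)
    (λ (mono , atLeast) → weak mono , atLeast)
    where
    weak : LexMonotone φ → ∀ a b → a ⪯ b → φ a ≤ φ b
    -- `LexMonotone` speaks of `≺` only, so equal elements are treated apart.
    weak mono a b a⪯b with a ≟ᴾ b
    ... | yes a≡b = ≤-reflexive (cong φ a≡b)
    ... | no  a≢b = lexKey-<⇒≤ φ (mono (a⪯b , a≢b))

theorem7 : ∀ {n : ℕ} (P : BicolouredPoset n)
    (ω : Labelling P) → ReverseNatural P ω →
    (τ : Labelling P) → Natural P τ →
    ∀ (x y : ℕ) →
    (Ω° P x y ≡ ∑ᴸ P (λ L → Ωʷ° P ω L x y))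
    × (Ω P x y ≡ ∑ᴸ P (λ L → Ωʷ P τ L x y))
theorem7 P ω ω-reverseNatural τ τ-natural x y =
  number≡∑ᴸ P ω (celesteAbove? P y) (strictlyOrderPreserving? P x y)
    (strictlyOrderPreserving⇔lexMonotone P ω ω-reverseNatural y) ,
  number≡∑ᴸ P τ (celesteAtLeast? P y) (orderPreserving? P x y)
    (orderPreserving⇔lexMonotone P τ τ-natural y)
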